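{- Let $\mathcal V$ be a decidable congruence class. Given a sequential transducer $\mathcal T$ over an alphabet $\Sigma$, it is decidable whether the transduction realized by $\mathcal T$ is $\mathcal V$-sequential.
   Context: A transduction over a finite alphabet $\Sigma$ is a partial function $f:\Sigma^*\to\Sigma^*$. An automaton $\mathcal A=(Q,\Delta,I,F)$ has $\Delta\subseteq Q\times\Sigma\times Q$; $p\xrightarrow{w}q$ means there is a run on $w$ from $p$ to $q$. It is deterministic if $|I|=1$ and $(p,\sigma,q_1),(p,\sigma,q_2)\in\Delta$ implies $q_1=q_2$. The transition congruence of $\mathcal A$ is $u\approx_{\mathcal A}v$ iff for all $p,q\in Q$: $p\xrightarrow{u}q\Leftrightarrow p\xrightarrow{v}q$. A congruence class $\mathcal V$ assigns to each finite alphabet $\Sigma$ a set $\mathcal V(\Sigma)$ of congruences of finite index on $\Sigma^*$ that is closed under intersection and under taking coarser congruences. A $\mathcal V$-automaton is an automaton whose transition congruence lies in $\mathcal V(\Sigma)$. $\mathcal V$ is decidable if, given a congruence of finite index presented as a monoid morphism $\mu:\Sigma^*\to M$ into a finite monoid (specified by the images of letters; $u\sim v$ iff $\mu(u)=\mu(v)$), membership of this congruence in $\mathcal V(\Sigma)$ is decidable. A transducer $\mathcal T=(\mathcal A,o,i,t)$ consists of an automaton $\mathcal A=(Q,\Delta,I,F)$, an output function $o:\Delta\to\Sigma^*$, an initial output $i:I\to\Sigma^*$ and a final output $t:F\to\Sigma^*$; it realizes the pairs $(u, i(q_0)\,o(\text{run})\,t(q_n))$ over accepting runs $q_0\dots q_n$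 on $u$, where $o(\text{run})$ is the concatenation of the transition outputs. It is sequential if $\mathcal A$ is deterministic (and it realizes a function). A $\mathcal V$-transducer is a transducer whose underlying automaton is a $\mathcal V$-automaton. A transduction is $\mathcal V$-sequential if it is realized by a sequential $\mathcal V$-transducer. -}

module Defs where

open import Algebra.Definitions using (Congruent₂)
open import Algebra.Structures using (IsMonoid)
open import Data.Fin.Base using (Fin; suc)
open import Data.Fin.Subset using (Subset; _∈_; ∣_∣; inside; outside)
open import Data.List.Base using (List; []; _∷_; _++_; foldr)
open import Data.Nat.Base using (ℕ)
import Data.Nat.Properties as ℕ
open import Data.Product using (Σ; ∃; _×_; _,_; proj₁; proj₂; zip)
open import Data.Vec.Base using (_∷_; here; there)
open import Data.Vec.Properties.WithK using ([]=-irrelevant)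
open import Function.Bundles using (_⇔_; mk⇔; Equivalence)
open import Function.Properties.Equivalence using (⇔-isEquivalence)
open import Level using (0ℓ; _⊔_) renaming (suc to lsuc)
open import Relation.Binary.Core using (Rel; _⇒_)
open import Relation.Binary.Structures using (IsEquivalence)
import Relation.Binary.Construct.Intersection as Inter
open import Relation.Binary.PropositionalEquality
  using (_≡_; refl; sym; trans; cong; cong₂; subst)
open import Relation.Nullary using (Dec; ¬_; contradiction)

-- The finite alphabet with k letters is Fin k.

Word : ℕ → Set
Word k = List (Fin k)

------------------------------------------------------------------------
-- Congruences

record Congruence (k : ℕ) : Set₁ where
  infix 4 _∼_
  field
    _∼_           : Rel (Word k) 0ℓ
    isEquivalence : IsEquivalence _∼_
    ++-cong       : Congruent₂ _∼_ _++_

open Congruence using (_∼_)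

-- At most m classes, for some m: words with the same label are congruent.
-- Congruent words may carry different labels, so congruence is not required
-- to be decidable; this makes the notion stable under coarsening and under
-- intersection without any appeal to excluded middle.

FiniteIndex : ∀ {k} → Congruence k → Set
FiniteIndex {k} R =
  ∃ λ m → Σ (Word k → Fin m) λ label → ∀ u v → label u ≡ label v → _∼_ R u v

infixr 7 _∩_

_∩_ : ∀ {k} → Congruence k → Congruence k → Congruence k
R ∩ S = record
  { _∼_           = R._∼_ Inter.∩ S._∼_
  ; isEquivalence = Inter.isEquivalence R.isEquivalence S.isEquivalence
  ; ++-cong       = zip R.++-cong S.++-cong
  } where module R = Congruence R
          module S = Congruence S

record CongruenceClass ℓ : Set (lsuc 0ℓ ⊔ lsuc ℓ) where
  field
    Member       : ∀ {k} → Congruence k → Set ℓ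
    finite-index : ∀ {k} (R : Congruence k) → Member R → FiniteIndex R
    ∩-closed     : ∀ {k} (R S : Congruence k) →
                   Member R → Member S → Member (R ∩ S)
    coarser      : ∀ {k} (R S : Congruence k) →
                   _∼_ R ⇒ _∼_ S → Member R → Member S

open CongruenceClass using (Member)

------------------------------------------------------------------------
-- Presentation of congruences by morphisms into finite monoids

record FiniteMonoid : Set where
  infixl 7 _∙_
  field
    size     : ℕ
    _∙_      : Fin size → Fin size → Fin size
    ε        : Fin size
    isMonoid : IsMonoid _≡_ _∙_ ε

  Carrier : Set
  Carrier = Fin size

module _ (M : FiniteMonoid) {k : ℕ} (μ : Fin k → FiniteMonoid.Carrier M) where
  open FiniteMonoid M
  open IsMonoid isMonoid using (assoc; identityˡ)

  -- The monoid morphism Σ* → M determined by the images of the letters.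
  extend : Word k → Carrier
  extend = foldr (λ σ m → μ σ ∙ m) ε

  extend-++ : ∀ u v → extend (u ++ v) ≡ extend u ∙ extend v
  extend-++ []      v = sym (identityˡ (extend v))
  extend-++ (σ ∷ u) v = trans (cong (μ σ ∙_) (extend-++ u v))
                              (sym (assoc (μ σ) (extend u) (extend v)))

  kernel : Congruence k
  kernel = record
    { _∼_           = λ u v → extend u ≡ extend v
    ; isEquivalence = record { refl = refl ; sym = sym ; trans = trans }
    ; ++-cong       = λ {u} {u′} {v} {v′} u∼u′ v∼v′ →
        trans (extend-++ u v)
              (trans (cong₂ _∙_ u∼u′ v∼v′) (sym (extend-++ u′ v′)))
    }

DecidableClass : ∀ {ℓ} → CongruenceClass ℓ → Set ℓ
DecidableClass V =
  ∀ (M : FiniteMonoid) {k} (μ : Fin k → FiniteMonoid.Carrier M) →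
  Dec (Member V (kernel M μ))

------------------------------------------------------------------------
-- Automata

-- (p , σ , q) is a transition when q ∈ Δ p σ.

record Automaton (k : ℕ) : Set where
  field
    size : ℕ

  State : Set
  State = Fin size

  field
    Δ : State → Fin k → Subset size
    I : Subset size
    F : Subset size

  infixr 5 _∷_

  data Run : State → Word k → State → Set where
    []  : ∀ {p} → Run p [] p
    _∷_ : ∀ {p σ q w r} → q ∈ Δ p σ → Run q w r → Run p (σ ∷ w) r

  Deterministic : Set
  Deterministic =
    ∣ I ∣ ≡ 1 × (∀ {p σ q₁ q₂} → q₁ ∈ Δ p σ → q₂ ∈ Δ p σ → q₁ ≡ q₂)

  run-++ : ∀ {p q r u v} → Run p u q → Run q v r → Run p (u ++ v) r
  run-++ []      ρ = ρ
  run-++ (δ ∷ τ) ρ = δ ∷ run-++ τ ρ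

  run-split : ∀ {p r} u {v} → Run p (u ++ v) r → ∃ λ q → Run p u q × Run q v r
  run-split []      ρ       = _ , [] , ρ
  run-split (_ ∷ u) (δ ∷ ρ) with q , τ , τ′ ← run-split u ρ = q , δ ∷ τ , τ′

  transitionCongruence : Congruence k
  transitionCongruence = record
    { _∼_           = _≈_
    ; isEquivalence = record
        { refl  = λ p q → ⇔.refl
        ; sym   = λ e p q → ⇔.sym (e p q)
        ; trans = λ e e′ p q → ⇔.trans (e p q) (e′ p q)
        }
    ; ++-cong       = λ {u} {u′} e e′ p r → mk⇔
        (λ ρ → let q , τ , τ′ = run-split u ρ in
               run-++ (Equivalence.to (e p q) τ) (Equivalence.to (e′ q r) τ′))
        (λ ρ → let q , τ , τ′ = run-split u′ ρ in
               run-++ (Equivalence.from (e p q) τ) (Equivalence.from (e′ q r) τ′))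
    } where
    _≈_ : Rel (Word k) 0ℓ
    u ≈ v = ∀ p q → Run p u q ⇔ Run p v q
    module ⇔ = IsEquivalence (⇔-isEquivalence {ℓ = 0ℓ})

------------------------------------------------------------------------
-- Transductions and transducers

-- A partial function Σ* → Σ*, given by its graph.

record Transduction (k : ℕ) : Set₁ where
  field
    graph      : Word k → Word k → Set
    functional : ∀ {u v v′} → graph u v → graph u v′ → v ≡ v′

record Transducer (k : ℕ) : Set where
  field
    automaton : Automaton k
  open Automaton automaton public
  field
    o : ∀ {p σ q} → q ∈ Δ p σ → Word k
    i : ∀ {q} → q ∈ I → Word k
    t : ∀ {q} → q ∈ F → Word k

  output : ∀ {p w q} → Run p w q → Word k
  output []      = []
  output (δ ∷ ρ) = o δ ++ output ρ

  data Realizes (u : Word k) : Word k → Set where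
    accept : ∀ {p q} (p∈I : p ∈ I) (ρ : Run p u q) (q∈F : q ∈ F) →
             Realizes u (i p∈I ++ output ρ ++ t q∈F)

-- Functionality of the realized relation is automatic; see functional below.

Sequential : ∀ {k} → Transducer k → Set
Sequential T = Transducer.Deterministic T

∈⇒∣∣≢0 : ∀ {n} {s : Subset n} {x} → x ∈ s → ¬ ∣ s ∣ ≡ 0
∈⇒∣∣≢0 {s = inside  ∷ _} _         ()
∈⇒∣∣≢0 {s = outside ∷ _} (there m) = ∈⇒∣∣≢0 m

∣∣≡1⇒unique : ∀ {n} {s : Subset n} {x y} → ∣ s ∣ ≡ 1 → x ∈ s → y ∈ s → x ≡ y
∣∣≡1⇒unique {s = inside  ∷ _} _  here       here       = refl
∣∣≡1⇒unique {s = inside  ∷ _} eq (there x∈) _          =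
  contradiction (ℕ.suc-injective eq) (∈⇒∣∣≢0 x∈)
∣∣≡1⇒unique {s = inside  ∷ _} eq here       (there y∈) =
  contradiction (ℕ.suc-injective eq) (∈⇒∣∣≢0 y∈)
∣∣≡1⇒unique {s = outside ∷ _} eq (there x∈) (there y∈) =
  cong suc (∣∣≡1⇒unique eq x∈ y∈)

module _ {k} (T : Transducer k) (sequential : Sequential T) where
  open Transducer T

  run-unique : ∀ {p w q q′} (ρ : Run p w q) (ρ′ : Run p w q′) →
               Σ (q ≡ q′) λ e → subst (Run p w) e ρ ≡ ρ′
  run-unique []      []        = refl , refl
  run-unique (δ ∷ ρ) (δ′ ∷ ρ′)
    with refl ← sequential .proj₂ δ δ′
    with refl ← []=-irrelevant δ δ′
    with refl , refl ← run-unique ρ ρ′ = refl , refl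

  functional : ∀ {u v v′} → Realizes u v → Realizes u v′ → v ≡ v′
  functional (accept p∈I ρ q∈F) (accept p∈I′ ρ′ q∈F′)
    with refl ← ∣∣≡1⇒unique (sequential .proj₁) p∈I p∈I′
    with refl ← []=-irrelevant p∈I p∈I′
    with refl , refl ← run-unique ρ ρ′
    with refl ← []=-irrelevant q∈F q∈F′ = refl

  transduction : Transduction k
  transduction = record { graph = Realizes ; functional = functional }

------------------------------------------------------------------------
-- 𝒱-automata, 𝒱-transducers and 𝒱-sequential transductions

module _ {ℓ} (V : CongruenceClass ℓ) where

  IsVAutomaton : ∀ {k} → Automaton k → Set ℓ
  IsVAutomaton A = Member V (Automaton.transitionCongruence A)

  IsVTransducer : ∀ {k} → Transducer k → Set ℓ
  IsVTransducer T = IsVAutomaton (Transducer.automaton T)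

  VSequential : ∀ {k} → Transduction k → Set ℓ
  VSequential {k} f =
    Σ (Transducer k) λ T → Sequential T × IsVTransducer T ×
      (∀ u v → Transducer.Realizes T u v ⇔ Transduction.graph f u v)

{-# OPTIONS --safe #-}

-- Among the sequential transducers for f there is one, Choffrut's minimal
-- transducer, whose transition congruence is coarser than that of every other;
-- so f is 𝒱-sequential iff this single congruence, presented by its action on
-- the states, belongs to 𝒱.  The minimal transducer is computed from a given
-- one by advancing outputs, which makes the longest common prefix of the outputs
-- from each live state empty, and then merging states with the same residual.
-- Minimality: if words u and v act alike on a transducer for f, then after any
-- w the words w u and w v lead it to the same state, so the residuals of f after
-- them agree up to a prefix, hence are equal once normalised.

module Submission where

open import Defs
open import Data.Empty using (⊥)
open import Data.Fin.Base using (Fin; zero; suc; toℕ; combine; funToFin; finToFun)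
import Data.Fin.Properties as Fin
open import Data.Fin.Subset using (Subset; _∈_; ⁅_⁆; Nonempty; ∣_∣) renaming (⊥ to ∅)
open import Data.Fin.Subset.Properties
  using (_∈?_; nonempty?; Empty-unique; ∣⊥∣≡0; ∉⊥; x∈⁅x⁆; x∈⁅y⁆⇒x≡y; ∣⁅x⁆∣≡1)
open import Data.List.Base using ([]; _∷_; _++_; length; take; drop)
import Data.List.Properties as List
open import Data.Maybe.Base using (Maybe; just; nothing; map; maybe; fromMaybe; is-just; _>>=_)
import Data.Maybe.Properties as Maybe
open import Data.Nat.Base using (ℕ; zero; suc; _≤_; _<_; _+_; _*_; _∸_; _⊓_; _^_; z≤n; s≤s)
open import Data.Nat.Induction using (<-wellFounded)
import Data.Nat.Properties as ℕ
open import Data.Product using (Σ; ∃; ∃₂; _×_; _,_; proj₁; proj₂)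
open import Data.Sum.Base using (inj₁; inj₂)
open import Data.Vec.Base using (tabulate)
open import Data.Vec.Properties using ([]=⇒lookup; lookup⇒[]=; lookup∘tabulate)
open import Data.Vec.Properties.WithK using ([]=-irrelevant)
open import Function.Base using (_∘_; id)
open import Function.Bundles using (_⇔_; mk⇔; Equivalence)
open import Induction.WellFounded using (Acc; acc)
open import Relation.Binary.Core using (_⇒_)
open import Relation.Binary.PropositionalEquality
open import Relation.Nullary using (Dec; yes; no; ¬_; contradiction)
open import Relation.Nullary.Decidable using (map′; _×-dec_; _⊎-dec_; ¬?; decidable-stable)
open import Relation.Unary using (Decidable)

private variable
  k n : ℕ

-- Searching a word that satisfies a property of finite index

-- Pumping: two prefixes of a word longer than `N` share a code, and deleting the factor between
-- them preserves `P`.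
shorten : ∀ {P : Word k → Set} {N} (code : Word k → Fin N) →
          (∀ {u v} w → code u ≡ code v → P (u ++ w) → P (v ++ w)) →
          ∀ w → Acc _<_ (length w) → P w → ∃ λ v → length v ≤ N × P v
shorten {P = P} {N} code compatible w (acc rec) Pw with ℕ.≤-<-connex (length w) N
... | inj₁ ∣w∣≤N = w , ∣w∣≤N , Pw
... | inj₂ N<∣w∣
  with i , j , i<j , same ←
    Fin.pigeonhole (ℕ.m<n⇒m<1+n N<∣w∣) (λ (i : Fin (suc (length w))) → code (take (toℕ i) w))
  = shorten code compatible (take a w ++ drop b w) (rec shorter)
      (compatible (drop b w) (sym same) (subst P (sym (List.take++drop≡id b w)) Pw))
  where
  a b : ℕ
  a = toℕ i
  b = toℕ j
  open ℕ.≤-Reasoning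
  b≤∣w∣ : b ≤ length w
  b≤∣w∣ = ℕ.≤-pred (Fin.toℕ<n j)
  shorter : length (take a w ++ drop b w) < length w
  shorter = begin-strict
    length (take a w ++ drop b w)         ≡⟨ List.length-++ (take a w) ⟩
    length (take a w) + length (drop b w) ≡⟨ cong₂ _+_ (List.length-take a w) (List.length-drop b w) ⟩
    a ⊓ length w + (length w ∸ b)
                                          ≤⟨ ℕ.+-monoˡ-≤ _ (ℕ.m⊓n≤m a (length w)) ⟩
    a + (length w ∸ b)      <⟨ ℕ.+-monoˡ-< _ i<j ⟩
    b + (length w ∸ b)      ≡⟨ ℕ.m+[n∸m]≡n b≤∣w∣ ⟩
    length w                              ∎

searchUpTo : ∀ {P : Word k → Set} → Decidable P → ∀ m → Dec (∃ λ w → length w ≤ m × P w)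
searchUpTo P? zero = map′ (λ P[] → [] , z≤n , P[]) (λ { ([] , _ , P[]) → P[] }) (P? [])
searchUpTo {P = P} P? (suc m) = map′
  (λ { (inj₁ P[])              → [] , z≤n , P[]
     ; (inj₂ (σ , w , ≤m , Pw)) → σ ∷ w , s≤s ≤m , Pw })
  (λ { ([] , _ , P[])         → inj₁ P[]
     ; (σ ∷ w , s≤s ≤m , Pw) → inj₂ (σ , w , ≤m , Pw) })
  (P? [] ⊎-dec Fin.any? λ σ → searchUpTo (P? ∘ (σ ∷_)) m)

-- Only words of length at most the number `N` of codes have to be tried, as longer witnesses can be
-- shortened.
search : ∀ {P : Word k → Set} → Decidable P → ∀ {N} (code : Word k → Fin N) →
         (∀ {u v} w → code u ≡ code v → P (u ++ w) → P (v ++ w)) → Dec (∃ P)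
search P? {N} code compatible = map′
  (λ (w , _ , Pw) → w , Pw)
  (λ (w , Pw) → shorten code compatible w (<-wellFounded _) Pw)
  (searchUpTo P? N)

-- The first `L` letters as digits in base `suc k`; the digit `zero` pads words that end earlier.
encode : ∀ L → Word k → Fin (suc k ^ L)
encode         zero    _       = zero
encode {k = k} (suc L) []      = combine {suc k} zero (encode L [])
encode         (suc L) (σ ∷ w) = combine (suc σ) (encode L w)

encode-take : ∀ L (u v : Word k) → encode L u ≡ encode L v → take L u ≡ take L v
encode-take zero    _       _       _  = refl
encode-take (suc L) []      []      _  = refl
encode-take (suc L) []      (τ ∷ v) eq
  with () ← Fin.combine-injectiveˡ zero (encode L []) (suc τ) (encode L v) eq
encode-take (suc L) (σ ∷ u) []      eq
  with () ← Fin.combine-injectiveˡ (suc σ) (encode L u) zero (encode L []) eq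
encode-take (suc L) (σ ∷ u) (τ ∷ v) eq
  with refl , eq′ ← Fin.combine-injective (suc σ) (encode L u) (suc τ) (encode L v) eq
  = cong (σ ∷_) (encode-take L u v eq′)

encodeMaybe : Maybe (Fin n) → Fin (suc n)
encodeMaybe = maybe suc zero

encodeMaybe-injective : (a b : Maybe (Fin n)) → encodeMaybe a ≡ encodeMaybe b → a ≡ b
encodeMaybe-injective (just _) (just _) refl = refl
encodeMaybe-injective nothing  nothing  _    = refl

-- Prefixes

infix 4 _≼_

-- As an equation on a truncation, this depends only on the first `length c` letters of `z`, a
-- finite amount of information.
_≼_ : Word k → Word k → Set
c ≼ z = take (length c) z ≡ c

≼-++ : ∀ (c s : Word k) → c ≼ c ++ s
≼-++ []      s = refl
≼-++ (a ∷ c) s = cong (a ∷_) (≼-++ c s)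

≼-drop : ∀ (c : Word k) {z} → c ≼ z → c ++ drop (length c) z ≡ z
≼-drop c {z} c≼z = trans (cong (_++ drop (length c) z) (sym c≼z)) (List.take++drop≡id (length c) z)

≼-++ˡ : ∀ (c : Word k) {d z} → c ++ d ≼ z → c ≼ z
≼-++ˡ c {d} {z} c++d≼z = subst (c ≼_)
  (trans (sym (List.++-assoc c d _)) (≼-drop (c ++ d) c++d≼z)) (≼-++ c _)

++-≼⁺ : ∀ (x : Word k) {c z} → c ≼ z → x ++ c ≼ x ++ z
++-≼⁺ []      c≼z = c≼z
++-≼⁺ (a ∷ x) c≼z = cong (a ∷_) (++-≼⁺ x c≼z)

++-≼-self : ∀ (x : Word k) {c} → x ++ c ≼ x → c ≡ []
++-≼-self []      {[]}    _     = refl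
++-≼-self (a ∷ x) {c}     x++c≼ = ++-≼-self x (List.∷-injectiveʳ x++c≼)

take-++-cong : ∀ L (u v w : Word k) → take L u ≡ take L v → take L (u ++ w) ≡ take L (v ++ w)
take-++-cong zero    u       v       w _  = refl
take-++-cong (suc L) []      []      w _  = refl
take-++-cong (suc L) (a ∷ u) (b ∷ v) w eq
  with refl , eq′ ← List.∷-injective eq = cong (a ∷_) (take-++-cong L u v w eq′)

-- The members of `C` are prefixes of `z`, hence form a chain; `z` is followed letter by letter
-- until `C` fails, and closure under prefixes excludes later members.
longest : ∀ {C : Word k → Set} → Decidable C → C [] → (∀ c {d} → C (c ++ d) → C c) →
          ∀ z → (∀ c → C c → c ≼ z) → ∃ λ l → C l × (∀ c → C c → c ≼ l)
longest C? C[] closed []      bounded = [] , C[] , bounded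
longest {C = C} C? C[] closed (a ∷ z) bounded with C? (a ∷ [])
... | no ¬Ca = [] , C[] , shorter
  where
  shorter : ∀ c → C c → c ≼ []
  shorter []      _  = refl
  shorter (b ∷ c) Cc with refl ← List.∷-injectiveˡ (bounded (b ∷ c) Cc)
    = contradiction (closed (a ∷ []) Cc) ¬Ca
... | yes Ca
  with l , Cl , maximal ← longest {C = C ∘ (a ∷_)} (C? ∘ (a ∷_)) Ca (λ c → closed (a ∷ c)) z
         (λ c Cc → List.∷-injectiveʳ (bounded (a ∷ c) Cc))
  = a ∷ l , Cl , maximal′
  where
  maximal′ : ∀ c → C c → c ≼ a ∷ l
  maximal′ []      _  = refl
  maximal′ (b ∷ c) Cc with refl ← List.∷-injectiveˡ (bounded (b ∷ c) Cc)
    = cong (a ∷_) (maximal c Cc)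

-- Partial functions on words

infixr 6 _⊙_

_⊙_ : Word k → Maybe (Word k) → Maybe (Word k)
x ⊙ m = map (x ++_) m

⊙-identity : (m : Maybe (Word k)) → [] ⊙ m ≡ m
⊙-identity = Maybe.map-id

⊙-assoc : ∀ (x y : Word k) m → (x ++ y) ⊙ m ≡ x ⊙ y ⊙ m
⊙-assoc x y nothing  = refl
⊙-assoc x y (just z) = cong just (List.++-assoc x y z)

⊙-just⁻ : ∀ {x : Word k} {m z} → x ⊙ m ≡ just z → ∃ λ s → m ≡ just s × x ++ s ≡ z
⊙-just⁻ {m = just s} refl = s , refl , refl

⊙-just : ∀ {x : Word k} {m s} → m ≡ just s → x ⊙ m ≡ just (x ++ s)
⊙-just refl = refl

⊙-cancel : ∀ (x : Word k) {m m′} → x ⊙ m ≡ x ⊙ m′ → m ≡ m′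
⊙-cancel x = Maybe.map-injective (List.++-cancelˡ x _ _)

just-or-nothing : ∀ {A : Set} {a b : Maybe A} → (∀ {z} → a ≡ just z → a ≡ b) →
                  (∀ {z} → b ≡ just z → a ≡ b) → a ≡ b
just-or-nothing {a = just _}                f g = f refl
just-or-nothing {a = nothing} {b = just _}  f g = g refl
just-or-nothing {a = nothing} {b = nothing} f g = refl

Live : (Word k → Maybe (Word k)) → Set
Live g = ∃₂ λ v z → g v ≡ just z

CommonPrefix : Word k → (Word k → Maybe (Word k)) → Set
CommonPrefix c g = ∀ v {z} → g v ≡ just z → c ≼ z

Normal : (Word k → Maybe (Word k)) → Set
Normal g = Live g × (∀ c → CommonPrefix c g → c ≡ [])

normal-leftmost : ∀ {g h : Word k → Maybe (Word k)} {a} {y} →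
                  Normal g → ¬ (∀ v → g v ≡ (a ∷ y) ⊙ h v)
normal-leftmost {g = g} {h} {a} {y} (_ , trivial) eq = contradiction (trivial (a ∷ []) common) λ ()
  where
  common : CommonPrefix (a ∷ []) g
  common v gv with s , _ , refl ← ⊙-just⁻ {m = h v} (trans (sym (eq v)) gv) = refl

-- The longest common prefix of x g is x when g is normal, so a function
-- determines its factorisation into a word and a normal function.
normal-cancel : ∀ {g h : Word k → Maybe (Word k)} x y → Normal g → Normal h →
                (∀ v → x ⊙ g v ≡ y ⊙ h v) → x ≡ y × (∀ v → g v ≡ h v)
normal-cancel []      []      ng nh eq =
  refl , λ v → trans (sym (⊙-identity _)) (trans (eq v) (⊙-identity _))
normal-cancel {h = h} []      (b ∷ y) ng nh eq =
  contradiction (λ v → trans (sym (⊙-identity _)) (eq v)) (normal-leftmost {h = h} ng)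
normal-cancel {g = g} (a ∷ x) []      ng nh eq =
  contradiction (λ v → trans (sym (⊙-identity _)) (sym (eq v))) (normal-leftmost {h = g} nh)
normal-cancel {g = g} {h} (a ∷ x) (b ∷ y) ng@((v₀ , z₀ , gv₀) , _) nh eq
  -- Liveness of `g` gives an input where both sides are defined, so the leading letters agree.
  with s , _ , bys ← ⊙-just⁻ {m = h v₀} (trans (sym (eq v₀)) (⊙-just gv₀))
  with refl ← List.∷-injectiveˡ bys
  with refl , g≗h ← normal-cancel x y ng nh
         (λ v → ⊙-cancel (a ∷ []) (trans (sym (⊙-assoc (a ∷ []) x (g v)))
           (trans (eq v) (⊙-assoc (a ∷ []) y (h v)))))
  = refl , g≗h

-- Deterministic transducers as partial functions

record Machine (n k : ℕ) : Set where
  field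
    step   : Fin n → Fin k → Maybe (Fin n × Word k)
    final  : Fin n → Maybe (Word k)
    init   : Fin n
    prefix : Word k

  eval : Fin n → Word k → Maybe (Word k)
  eval p []      = final p
  eval p (σ ∷ w) = step p σ >>= λ (q , x) → x ⊙ eval q w

  state : Fin n → Word k → Maybe (Fin n)
  state p []      = just p
  state p (σ ∷ w) = step p σ >>= λ (q , _) → state q w

  -- [] when the run is stuck.
  out : Fin n → Word k → Word k
  out p []      = []
  out p (σ ∷ w) = maybe (λ (q , x) → x ++ out q w) [] (step p σ)

  behaviour : Word k → Maybe (Word k)
  behaviour u = prefix ⊙ eval init u

  eval-step : ∀ {p σ q x} → step p σ ≡ just (q , x) → ∀ v → eval p (σ ∷ v) ≡ x ⊙ eval q v
  eval-step eq v rewrite eq = refl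

  state-++ : ∀ p u v → state p (u ++ v) ≡ (state p u >>= λ q → state q v)
  state-++ p []      v = refl
  state-++ p (σ ∷ u) v with step p σ
  ... | nothing      = refl
  ... | just (q , _) = state-++ q u v

  state-++-congˡ : ∀ p u v w → state p u ≡ state p v → state p (u ++ w) ≡ state p (v ++ w)
  state-++-congˡ p u v w eq =
    trans (state-++ p u w) (trans (cong (_>>= λ q → state q w) eq) (sym (state-++ p v w)))

  eval-stuck : ∀ p u v → state p u ≡ nothing → eval p (u ++ v) ≡ nothing
  eval-stuck p (σ ∷ u) v stuck with step p σ
  ... | nothing      = refl
  ... | just (q , x) = cong (x ⊙_) (eval-stuck q u v stuck)

  eval-++ : ∀ p u v {q} → state p u ≡ just q → eval p (u ++ v) ≡ out p u ⊙ eval q v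
  eval-++ p []      v refl = sym (⊙-identity _)
  eval-++ p (σ ∷ u) v run with step p σ
  ... | just (r , x) = trans (cong (x ⊙_) (eval-++ r u v run)) (sym (⊙-assoc x (out r u) (eval _ v)))

  eval-just⁻ : ∀ p u v {z} → eval p (u ++ v) ≡ just z → ∃ λ q → state p u ≡ just q × Live (eval q)
  eval-just⁻ p u v defined with state p u in run
  ... | nothing with () ← trans (sym (eval-stuck p u v run)) defined
  ... | just q with s , evalq , _ ← ⊙-just⁻ {m = eval q v} (trans (sym (eval-++ p u v run)) defined)
    = q , refl , v , s , evalq

  -- The output emitted while reading `w`, initial output included; the residual function itself is
  -- `eval` at the state reached.
  residual : Word k → Word k
  residual w = prefix ++ out init w

  behaviour-residual : ∀ w {p} → state init w ≡ just p → ∀ z → behaviour (w ++ z) ≡ residual w ⊙ eval p z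
  behaviour-residual w {p} reach z =
    trans (cong (prefix ⊙_) (eval-++ init w z reach)) (sym (⊙-assoc prefix (out init w) (eval p z)))

  behaviour-just⁻ : ∀ w z {v} → behaviour (w ++ z) ≡ just v → ∃ λ p → state init w ≡ just p
  behaviour-just⁻ w z eq
    with _ , evaluated , _ ← ⊙-just⁻ {m = eval init (w ++ z)} eq
    with p , reach , _ ← eval-just⁻ init w z evaluated = p , reach

open Machine

-- Deciding liveness and computing longest common prefixes

take-⊙-cong : ∀ L (x y : Word k) m → take L x ≡ take L y →
              map (take L) (x ⊙ m) ≡ map (take L) (y ⊙ m)
take-⊙-cong L x y nothing  _  = refl
take-⊙-cong L x y (just z) eq = cong just (take-++-cong L x y z eq)

module _ (A : Machine n k) where

  -- The state reached and the first `L` letters emitted determine the truncated output on every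
  -- continuation, and there are finitely many such pairs.
  searchTruncated : ∀ L p {Q : Maybe (Word k) → Set} → Decidable Q →
                    Dec (∃ λ w → Q (map (take L) (eval A p w)))
  searchTruncated L p {Q} Q? = search (λ w → Q? _)
    (λ w → combine (encodeMaybe (state A p w)) (encode L (out A p w)))
    (λ {u} {v} → compatible u v)
    where
    same-state : ∀ u v w → state A p u ≡ state A p v → take L (out A p u) ≡ take L (out A p v) →
                 map (take L) (eval A p (u ++ w)) ≡ map (take L) (eval A p (v ++ w))
    same-state u v w states outs with state A p v in run
    ... | nothing = cong (map (take L)) (trans (eval-stuck A p u w states) (sym (eval-stuck A p v w run)))
    ... | just q  = trans (cong (map (take L)) (eval-++ A p u w states))
      (trans (take-⊙-cong L (out A p u) (out A p v) (eval A q w) outs)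
             (sym (cong (map (take L)) (eval-++ A p v w run))))

    compatible : ∀ u v w →
      combine (encodeMaybe (state A p u)) (encode L (out A p u)) ≡
      combine (encodeMaybe (state A p v)) (encode L (out A p v)) →
      Q (map (take L) (eval A p (u ++ w))) → Q (map (take L) (eval A p (v ++ w)))
    compatible u v w eq
      with states , outs ← Fin.combine-injective (encodeMaybe (state A p u)) (encode L (out A p u))
                             (encodeMaybe (state A p v)) (encode L (out A p v)) eq
      = subst Q (same-state u v w
          (encodeMaybe-injective _ _ states)
          (encode-take L (out A p u) (out A p v) outs))

  abstract
    live? : ∀ p → Dec (Live (eval A p))
    live? p = map′
      (λ (w , defined) → w , just⁻ (eval A p w) defined)
      (λ (w , z , eq) → w , λ none → contradiction (trans (sym (cong (map (take 0)) eq)) none) λ ())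
      -- Truncation to length 0 retains exactly whether the output is defined.
      (searchTruncated 0 p (λ m → ¬? (Maybe.≡-dec (List.≡-dec Fin._≟_) m nothing)))
      where
      just⁻ : (m : Maybe (Word k)) → map (take 0) m ≢ nothing → ∃ λ z → m ≡ just z
      just⁻ (just z) _ = z , refl
      just⁻ nothing  d = contradiction refl d

  -- The search is for a counterexample, an output whose first `length c` letters differ from `c`.
  commonPrefix? : ∀ p c → Dec (CommonPrefix c (eval A p))
  commonPrefix? p c with searchTruncated (length c) p outside?
    where
    Outside : Maybe (Word k) → Set
    Outside = maybe (_≢ c) ⊥
    outside? : Decidable Outside
    outside? nothing  = no id
    outside? (just t) = ¬? (List.≡-dec Fin._≟_ t c)
  ... | yes (w , outside) = no λ common → refute common (eval A p w) refl outside
    where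
    refute : CommonPrefix c (eval A p) → ∀ m → eval A p w ≡ m →
             ¬ maybe (_≢ c) ⊥ (map (take (length c)) m)
    refute common (just z) eq c⋠z = c⋠z (common w eq)
  ... | no none = yes λ v eq → decidable-stable (List.≡-dec Fin._≟_ _ c) λ c⋠z →
          none (v , subst (λ m → maybe (_≢ c) ⊥ (map (take (length c)) m)) (sym eq) c⋠z)

  abstract
    lcp-exists : ∀ p → ∃ λ l → CommonPrefix l (eval A p) ×
                 (Live (eval A p) → ∀ c → CommonPrefix c (eval A p) → c ≼ l)
    lcp-exists p with live? p
    -- Every word is vacuously a common prefix at a dead state; the empty one is a conventional
    -- choice.
    ... | no dead = [] , (λ v _ → refl) , λ live → contradiction live dead
    ... | yes (v , z , evalv)
      with l , common , maximal ← longest (commonPrefix? p) (λ v _ → refl)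
             (λ c common v eq → ≼-++ˡ c (common v eq)) z (λ c common → common v evalv)
      = l , common , λ _ → maximal

  lcp : Fin n → Word k
  lcp p = proj₁ (lcp-exists p)

  lcp-common : ∀ p → CommonPrefix (lcp p) (eval A p)
  lcp-common p = proj₁ (proj₂ (lcp-exists p))

  lcp-greatest : ∀ p → Live (eval A p) → ∀ c → CommonPrefix c (eval A p) → c ≼ lcp p
  lcp-greatest p = proj₂ (proj₂ (lcp-exists p))

  -- This bounds the prefix at the source of a transition by its label `x` followed by the prefix at
  -- its target, so that advancing outputs subtracts only what is there.
  lcp-greatest-++ : ∀ p → Live (eval A p) → ∀ x c →
                    (∀ v {z} → eval A p v ≡ just z → c ≼ x ++ z) → c ≼ x ++ lcp p
  lcp-greatest-++ p live []      c  common = lcp-greatest p live c common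
  lcp-greatest-++ p live (a ∷ x) [] common = refl
  lcp-greatest-++ p live@(v , _ , evalv) (a ∷ x) (b ∷ c) common
    with refl ← List.∷-injectiveˡ (common v evalv)
    = cong (a ∷_) (lcp-greatest-++ p live x c λ v eq → List.∷-injectiveʳ (common v eq))

-- Choffrut's normalisation: outputs are produced as early as possible and
-- transitions into dead states are removed.
normalise : Machine n k → Machine n k
normalise {n} {k} A = record
  { step   = λ p σ → step A p σ >>= λ (q , x) → arrow p q x (live? A q)
  ; final  = λ p → map (drop (length (lcp A p))) (final A p)
  ; init   = init A
  ; prefix = prefix A ++ lcp A (init A)
  }
  where
  arrow : ∀ p q → Word k → Dec (Live (eval A q)) → Maybe (Fin n × Word k)
  arrow p q x (yes _) = just (q , drop (length (lcp A p)) (x ++ lcp A q))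
  arrow p q x (no _)  = nothing

module _ (A : Machine n k) where
  private N = normalise A

  -- The prefixes telescope along a run: each new label gains the prefix of its target and loses
  -- that of its source, which is what `lcp A p` contributes in front.
  factorise : ∀ p v → eval A p v ≡ lcp A p ⊙ eval N p v
  factorise p [] with final A p in eq
  ... | nothing = refl
  ... | just z  = cong just (sym (≼-drop (lcp A p) (lcp-common A p [] eq)))
  factorise p (σ ∷ v) with step A p σ in eq
  ... | nothing = refl
  ... | just (q , x) with live? A q
  ...   | no dead = helper (eval A q v) refl
    where
    helper : ∀ m → eval A q v ≡ m → x ⊙ m ≡ nothing
    helper nothing  _     = refl
    helper (just z) evalv = contradiction (v , z , evalv) dead
  ...   | yes live = begin
    x ⊙ eval A q v                    ≡⟨ cong (x ⊙_) (factorise q v) ⟩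
    x ⊙ lcp A q ⊙ eval N q v          ≡⟨ ⊙-assoc x (lcp A q) (eval N q v) ⟨
    (x ++ lcp A q) ⊙ eval N q v       ≡⟨ cong (_⊙ eval N q v) (≼-drop (lcp A p) lcp≼) ⟨
    (lcp A p ++ drop (length (lcp A p)) (x ++ lcp A q)) ⊙ eval N q v
                                      ≡⟨ ⊙-assoc (lcp A p) _ (eval N q v) ⟩
    lcp A p ⊙ drop (length (lcp A p)) (x ++ lcp A q) ⊙ eval N q v ∎
    where
    open ≡-Reasoning
    lcp≼ : lcp A p ≼ x ++ lcp A q
    lcp≼ = lcp-greatest-++ A q live x (lcp A p) λ v evalv →
      lcp-common A p (σ ∷ v) (trans (eval-step A eq v) (⊙-just evalv))

  live-normalise : ∀ {p} → Live (eval A p) → Live (eval N p)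
  live-normalise {p} (v , z , evalv)
    with s , eq , _ ← ⊙-just⁻ {m = eval N p v} (trans (sym (factorise p v)) evalv) = v , s , eq

  live-normalise⁻ : ∀ {p} → Live (eval N p) → Live (eval A p)
  live-normalise⁻ {p} (v , z , evalv) = v , _ , trans (factorise p v) (⊙-just evalv)

  -- A common prefix of the new outputs would extend `lcp A p` to a common prefix of the old ones,
  -- against its maximality.
  normalise-normal : ∀ {p} → Live (eval A p) → Normal (eval N p)
  normalise-normal {p} live = live-normalise live , λ c common → ++-≼-self (lcp A p)
    (lcp-greatest A p live (lcp A p ++ c) (extended common))
    where
    extended : ∀ {c} → CommonPrefix c (eval N p) → CommonPrefix (lcp A p ++ c) (eval A p)
    extended common v evalv
      with s , eq , refl ← ⊙-just⁻ {m = eval N p v} (trans (sym (factorise p v)) evalv)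
      = ++-≼⁺ (lcp A p) (common v eq)

  normalise-step : ∀ {p σ q y} → step N p σ ≡ just (q , y) → Live (eval A q)
  normalise-step {p} {σ} eq with step A p σ
  ... | just (q , x) with live? A q | eq
  ...   | yes live | refl = live

  normalise-behaviour : ∀ u → behaviour A u ≡ behaviour N u
  normalise-behaviour u = trans (cong (prefix A ⊙_) (factorise (init A) u))
                                (sym (⊙-assoc (prefix A) (lcp A (init A)) (eval N (init A) u)))


-- Least elements of decidable sets

first : {P : Fin n → Set} → Decidable P → Maybe (Fin n)
first {zero}  P? = nothing
first {suc n} P? with P? zero
... | yes _ = just zero
... | no _  = map suc (first (P? ∘ suc))

first-just : {P : Fin n → Set} (P? : Decidable P) → ∀ {i} → first P? ≡ just i → P i
first-just {suc n} P? eq with P? zero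
first-just {suc n} P? refl | yes P0 = P0
first-just {suc n} P? eq   | no _ with first (P? ∘ suc) in found
first-just {suc n} P? refl | no _ | just i = first-just (P? ∘ suc) found

first-nothing : {P : Fin n → Set} (P? : Decidable P) → first P? ≡ nothing → ∀ i → ¬ P i
first-nothing {suc n} P? eq i Pi with P? zero
first-nothing {suc n} P? eq i       Pi | no ¬P0 with first (P? ∘ suc) in found
first-nothing {suc n} P? eq zero    P0 | no ¬P0 | nothing = ¬P0 P0
first-nothing {suc n} P? eq (suc i) Pi | no ¬P0 | nothing = first-nothing (P? ∘ suc) found i Pi

-- The least element depends only on the set, so a choice made in an equivalence class does not
-- depend on the member from which it is made.
first-cong : {P Q : Fin n → Set} (P? : Decidable P) (Q? : Decidable Q) →
             (∀ i → P i → Q i) → (∀ i → Q i → P i) → first P? ≡ first Q?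
first-cong {zero}  P? Q? P⇒Q Q⇒P = refl
first-cong {suc n} P? Q? P⇒Q Q⇒P with P? zero | Q? zero
... | yes _  | yes _  = refl
... | yes P0 | no ¬Q0 = contradiction (P⇒Q zero P0) ¬Q0
... | no ¬P0 | yes Q0 = contradiction (Q⇒P zero Q0) ¬P0
... | no _   | no _   = cong (map suc) (first-cong (P? ∘ suc) (Q? ∘ suc) (P⇒Q ∘ suc) (Q⇒P ∘ suc))

-- Merging states with equal residuals

module Reduction (N : Machine n k)
  (normal : ∀ {p} → Live (eval N p) → Normal (eval N p))
  (target-live : ∀ {p σ q y} → step N p σ ≡ just (q , y) → Live (eval N q)) where

  infix 4 _~_ _~?_

  _~_ : Fin n → Fin n → Set
  p ~ q = ∀ w → eval N p w ≡ eval N q w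

  ~-sym : ∀ {p q} → p ~ q → q ~ p
  ~-sym p~q w = sym (p~q w)

  ~-trans : ∀ {p q r} → p ~ q → q ~ r → p ~ r
  ~-trans p~q q~r w = trans (p~q w) (q~r w)

  -- Targets are live, hence normal, so the residual after `σ` splits uniquely into a label and a
  -- normal function. Equivalence is thereby a bisimulation.
  ~-step : ∀ {p q σ p′ x} → p ~ q → step N p σ ≡ just (p′ , x) →
           ∃ λ q′ → step N q σ ≡ just (q′ , x) × p′ ~ q′
  ~-step {p} {q} {σ} {p′} {x} p~q stepp with step N q σ in stepq
  ... | just (q′ , y)
    with refl , p′~q′ ← normal-cancel x y (normal (target-live stepp)) (normal (target-live stepq))
           (λ v → trans (sym (eval-step N stepp v)) (trans (p~q (σ ∷ v)) (eval-step N stepq v)))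
    = q′ , refl , p′~q′
  ... | nothing
    -- The live target accepts some continuation, on which a state without the transition would be
    -- undefined.
    with v , z , evalv ← target-live stepp
    with () ← trans (sym (⊙-just evalv)) (trans (sym (eval-step N stepp v))
                (trans (p~q (σ ∷ v)) (cong (_>>= λ (q , x) → x ⊙ eval N q v) stepq)))

  Compatible : Fin n → Fin n → Set
  Compatible p q = final N p ≡ final N q × (∀ σ → map proj₂ (step N p σ) ≡ map proj₂ (step N q σ))

  compatible? : ∀ p q → Dec (Compatible p q)
  compatible? p q = Maybe.≡-dec (List.≡-dec Fin._≟_) _ _
    ×-dec Fin.all? λ σ → Maybe.≡-dec (List.≡-dec Fin._≟_) _ _

  ~⇒compatible : ∀ {p q} → p ~ q → Compatible p q
  ~⇒compatible {p} {q} p~q = p~q [] , λ σ → just-or-nothing (labels p~q) (λ eq → sym (labels (~-sym p~q) eq))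
    where
    labels : ∀ {p q σ z} → p ~ q → map proj₂ (step N p σ) ≡ just z →
             map proj₂ (step N p σ) ≡ map proj₂ (step N q σ)
    labels {p} {q} {σ} p~q _ with step N p σ in stepp
    ... | just (p′ , x) with q′ , stepq , _ ← ~-step p~q stepp rewrite stepq = refl

  -- A run stuck on one side only is no clash: the missing transition already made an earlier pair
  -- of states incompatible.
  Clash : Maybe (Fin n) → Maybe (Fin n) → Set
  Clash (just p) (just q) = ¬ Compatible p q
  Clash _        _        = ⊥

  clash? : ∀ p q → Dec (Clash p q)
  clash? (just p) (just q) = ¬? (compatible? p q)
  clash? (just p) nothing  = no id
  clash? nothing  _        = no id

  clash-free : ∀ {p q} → p ~ q → ∀ w → ¬ Clash (state N p w) (state N q w)
  clash-free p~q []      clash = clash (~⇒compatible p~q)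
  clash-free {p} {q} p~q (σ ∷ w) with step N p σ in stepp
  ... | nothing = id
  ... | just (p′ , x) with q′ , stepq , p′~q′ ← ~-step p~q stepp rewrite stepq = clash-free p′~q′ w

  clash-free⇒~ : ∀ p q → (∀ w → ¬ Clash (state N p w) (state N q w)) → p ~ q
  clash-free⇒~ p q free [] = proj₁ (decidable-stable (compatible? p q) (free []))
  clash-free⇒~ p q free (σ ∷ w)
    with labels ← proj₂ (decidable-stable (compatible? p q) (free [])) σ | rest ← (λ w → free (σ ∷ w))
    with step N p σ | step N q σ
  ... | nothing       | nothing       = refl
  ... | just (p′ , x) | just (q′ , y) with refl ← labels = cong (x ⊙_) (clash-free⇒~ p′ q′ rest w)

  -- Inequivalence is witnessed by a word leading to a clash, and the pair of states reached is a
  -- sufficient code for the search.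
  _~?_ : ∀ p q → Dec (p ~ q)
  p ~? q = map′ (λ none → clash-free⇒~ p q λ w clash → none (w , clash))
                (λ p~q (w , clash) → clash-free p~q w clash)
                (¬? (search (λ w → clash? _ _) code λ {u} {v} → compatible u v))
    where
    code : Word k → Fin (suc n * suc n)
    code w = combine (encodeMaybe (state N p w)) (encodeMaybe (state N q w))

    compatible : ∀ u v w → code u ≡ code v →
                 Clash (state N p (u ++ w)) (state N q (u ++ w)) →
                 Clash (state N p (v ++ w)) (state N q (v ++ w))
    compatible u v w eq
      with eqp , eqq ← Fin.combine-injective (encodeMaybe (state N p u)) (encodeMaybe (state N q u)) _ _ eq
      = subst₂ Clash (state-++-congˡ N p u v w (encodeMaybe-injective _ _ eqp))
                     (state-++-congˡ N q u v w (encodeMaybe-injective _ _ eqq))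

  Accessible : Fin n → Set
  Accessible p = ∃ λ w → state N (init N) w ≡ just p

  accessible? : Decidable Accessible
  accessible? p = search (λ w → Maybe.≡-dec Fin._≟_ _ _) (λ w → encodeMaybe (state N (init N) w))
    λ {u} {v} w eq reach →
      trans (state-++-congˡ N (init N) v u w (encodeMaybe-injective _ _ (sym eq))) reach

  accessible-step : ∀ {p σ q y} → Accessible p → step N p σ ≡ just (q , y) → Accessible q
  accessible-step {p} {σ} (w , reach) stepp = w ++ σ ∷ [] ,
    trans (state-++ N (init N) w (σ ∷ []))
          (trans (cong (_>>= λ q → state N q (σ ∷ [])) reach)
                 (cong (_>>= λ (q , _) → just q) stepp))

  Useful : Fin n → Set
  Useful p = Accessible p × Live (eval N p)

  candidate? : ∀ p → Decidable (λ q → Useful q × q ~ p)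
  candidate? p q = (accessible? q ×-dec live? N q) ×-dec (q ~? p)

  abstract
    -- The default `p` occurs when no useful state is equivalent to `p`, as for a dead initial
    -- state.
    canon : Fin n → Fin n
    canon p = fromMaybe p (first (candidate? p))

    canon-~ : ∀ p → canon p ~ p
    canon-~ p with first (candidate? p) in found
    ... | just q  = proj₂ (first-just (candidate? p) found)
    ... | nothing = λ _ → refl

    canon-useful : ∀ {p} → Useful p → Useful (canon p)
    canon-useful {p} useful with first (candidate? p) in found
    ... | just q  = proj₁ (first-just (candidate? p) found)
    ... | nothing = useful

    -- Equivalent states have the same candidates; usefulness of `p` makes this set nonempty, which
    -- excludes the defaults.
    canon-cong : ∀ {p q} → Useful p → p ~ q → canon p ≡ canon q
    canon-cong {p} {q} useful p~q
      rewrite sym (first-cong (candidate? p) (candidate? q)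
                     (λ _ (u , r~p) → u , ~-trans r~p p~q)
                     (λ _ (u , r~q) → u , ~-trans r~q (~-sym p~q)))
      with first (candidate? p) in found
    ... | just _  = refl
    ... | nothing = contradiction (useful , λ _ → refl) (first-nothing (candidate? p) found p)

  -- These are the states of the minimal transducer. The others stay in `Fin n`, which avoids
  -- renumbering.
  Good : Fin n → Set
  Good p = Useful p × canon p ≡ p

  good? : Decidable Good
  good? p = (accessible? p ×-dec live? N p) ×-dec (canon p Fin.≟ p)

  good-canon : ∀ {p} → Useful p → Good (canon p)
  good-canon {p} useful = canon-useful useful , canon-cong (canon-useful useful) (canon-~ p)

  good-separated : ∀ {p q} → Good p → Good q → p ~ q → p ≡ q
  good-separated (useful , eqp) (_ , eqq) p~q = trans (sym eqp) (trans (canon-cong useful p~q) eqq)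

  -- A silent loop on every letter at each superfluous state: such a state
  -- cannot distinguish any two words in the transition congruence.
  reduce : Machine n k
  reduce = record
    { step   = λ p σ → redirect p (step N p σ) (good? p)
    ; final  = λ p → ending p (good? p)
    ; init   = canon (init N)
    ; prefix = prefix N
    }
    where
    redirect : ∀ p → Maybe (Fin n × Word k) → Dec (Good p) → Maybe (Fin n × Word k)
    redirect p arrow (yes _) = map (λ (q , y) → canon q , y) arrow
    redirect p arrow (no _)  = just (p , [])
    ending : ∀ p → Dec (Good p) → Maybe (Word k)
    ending p (yes _) = final N p
    ending p (no _)  = nothing

  private M = reduce

  reduce-eval : ∀ {p} → Good p → ∀ w → eval M p w ≡ eval N p w
  reduce-eval {p} good [] with good? p
  ... | yes _   = refl
  ... | no ¬good = contradiction good ¬good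
  reduce-eval {p} good (σ ∷ w) with good? p
  ... | no ¬good = contradiction good ¬good
  ... | yes ((acc-p , _) , _) with step N p σ in stepp
  ...   | nothing      = refl
  ...   | just (q , y) with useful ← accessible-step acc-p stepp , target-live stepp
    = cong (y ⊙_) (trans (reduce-eval (good-canon useful) w) (canon-~ q w))

  reduce-eval-bad : ∀ {p} → ¬ Good p → ∀ w → eval M p w ≡ nothing
  reduce-eval-bad {p} bad [] with good? p
  ... | yes good = contradiction good bad
  ... | no _     = refl
  reduce-eval-bad {p} bad (σ ∷ w) with good? p
  ... | yes good = contradiction good bad
  ... | no _     = cong ([] ⊙_) (reduce-eval-bad bad w)

  reduce-state-bad : ∀ {p} → ¬ Good p → ∀ w → state M p w ≡ just p
  reduce-state-bad {p} bad [] = refl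
  reduce-state-bad {p} bad (σ ∷ w) with good? p
  ... | yes good = contradiction good bad
  ... | no _     = reduce-state-bad bad w

  reduce-state-good : ∀ {p q} w → Good p → state M p w ≡ just q → Good q
  reduce-state-good [] good refl = good
  reduce-state-good {p} (σ ∷ w) good reach with good? p
  ... | no ¬good = contradiction good ¬good
  ... | yes ((acc-p , _) , _) with step N p σ in stepp
  ...   | just (q , y) = reduce-state-good w (good-canon (accessible-step acc-p stepp , target-live stepp)) reach

  reduce-behaviour : ∀ u → behaviour N u ≡ behaviour M u
  reduce-behaviour u = cong (prefix N ⊙_) (init-eval (good? (canon (init N))) (eval N (init N) u) refl)
    where
    init-eval : Dec (Good (canon (init N))) → ∀ m → eval N (init N) u ≡ m → m ≡ eval M (canon (init N)) u
    init-eval (yes good) m        eq = trans (sym eq) (sym (trans (reduce-eval good u) (canon-~ (init N) u)))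
    init-eval (no bad)   nothing  eq = sym (reduce-eval-bad bad u)
    -- A defined value makes the initial state useful, and then its representative is good.
    init-eval (no bad)   (just z) eq = contradiction (good-canon (([] , refl) , u , z , eq)) bad

  good-normal : ∀ {p} → Good p → Normal (eval M p)
  good-normal good@((_ , live) , _) with (v , z , evalv) , trivial ← normal live
    = (v , z , trans (reduce-eval good v) evalv)
    , λ c common → trivial c λ v eq → common v (trans (reduce-eval good v) eq)

  -- The word `w` reaches `p` in `N`. As behaviours agree and `p` keeps its residual, it serves the
  -- reduced machine too, with the output of `N` on `w` as `c`.
  good-residual : ∀ {p} → Good p → ∃₂ λ w c → ∀ z → behaviour M (w ++ z) ≡ c ⊙ eval M p z
  good-residual {p} good@(((w , reach) , _) , _) = w , residual N w , λ z → begin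
    behaviour M (w ++ z)        ≡⟨ reduce-behaviour (w ++ z) ⟨
    behaviour N (w ++ z)        ≡⟨ behaviour-residual N w reach z ⟩
    residual N w ⊙ eval N p z   ≡⟨ cong (residual N w ⊙_) (reduce-eval good z) ⟨
    residual N w ⊙ eval M p z   ∎
    where open ≡-Reasoning

  -- Minimality of the reduced machine

  module _ {n′} (B : Machine n′ k) (B≗M : ∀ u → behaviour B u ≡ behaviour M u)
           {p} (good : Good p) {r} w (reach : state B (init B) w ≡ just r)
           {c} (residual-p : ∀ z → behaviour M (w ++ z) ≡ c ⊙ eval M p z) where

    residual-common : ∀ z → c ⊙ eval M p z ≡ residual B w ⊙ eval B r z
    residual-common z = trans (sym (residual-p z)) (trans (sym (B≗M (w ++ z))) (behaviour-residual B w reach z))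

    -- s determines the residual at q: words x leading B to the same s lead M to the same q.
    residual-unique : ∀ x {q s} → state M p x ≡ just q → state B r x ≡ just s → Live (eval B s) →
                      ∀ z → eval M q z ≡ eval (normalise B) s z
    residual-unique x {q} {s} reachM reachB live = proj₂ (normal-cancel (c ++ out M p x)
      -- Moving `lcp B s` into the emitted output leaves a normal function on the side of `B`.
      (residual B w ++ out B r x ++ lcp B s)
      (good-normal (reduce-state-good x good reachM)) (normalise-normal B live) λ z → begin
      (c ++ out M p x) ⊙ eval M q z                    ≡⟨ ⊙-assoc c (out M p x) (eval M q z) ⟩
      c ⊙ out M p x ⊙ eval M q z                       ≡⟨ cong (c ⊙_) (eval-++ M p x z reachM) ⟨
      c ⊙ eval M p (x ++ z)                            ≡⟨ residual-common (x ++ z) ⟩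
      residual B w ⊙ eval B r (x ++ z)                 ≡⟨ cong (residual B w ⊙_) (eval-++ B r x z reachB) ⟩
      residual B w ⊙ out B r x ⊙ eval B s z            ≡⟨ cong (λ m → residual B w ⊙ out B r x ⊙ m) (factorise B s z) ⟩
      residual B w ⊙ out B r x ⊙ lcp B s ⊙ eval (normalise B) s z
        ≡⟨ cong (residual B w ⊙_) (⊙-assoc (out B r x) (lcp B s) (eval (normalise B) s z)) ⟨
      residual B w ⊙ (out B r x ++ lcp B s) ⊙ eval (normalise B) s z
        ≡⟨ ⊙-assoc (residual B w) (out B r x ++ lcp B s) (eval (normalise B) s z) ⟨
      (residual B w ++ out B r x ++ lcp B s) ⊙ eval (normalise B) s z ∎)
      where open ≡-Reasoning

    -- Since `q` is live, `B` reaches a live state `s` on `u`, hence also on `v`. So the run of `M`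
    -- on `v` survives, and its end state has the same normalised residual as `q`; good states with
    -- equal residuals coincide.
    states-agree : ∀ u v → (∀ s → state B r u ≡ just s → state B r v ≡ just s) →
                   ∀ {q} → state M p u ≡ just q → state M p v ≡ just q
    states-agree u v u⇒v {q} reachMu
      with good-q ← reduce-state-good u good reachMu
      with (zu , _ , evalq) , _ ← good-normal good-q
      with _ , evalBu , _ ← ⊙-just⁻ {m = eval B r (u ++ zu)} (trans (sym (residual-common (u ++ zu)))
             (⊙-just (trans (eval-++ M p u zu reachMu) (⊙-just evalq))))
      with s , reachBu , live@(zv , _ , evals) ← eval-just⁻ B r u zu evalBu
      with reachBv ← u⇒v s reachBu
      with _ , evalMv , _ ← ⊙-just⁻ {m = eval M p (v ++ zv)} (trans (residual-common (v ++ zv))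
             (⊙-just (trans (eval-++ B r v zv reachBv) (⊙-just evals))))
      with q′ , reachMv , _ ← eval-just⁻ M p v zv evalMv
      with good-q′ ← reduce-state-good v good reachMv
      = trans reachMv (cong just (good-separated good-q′ good-q λ z → begin
        eval N q′ z             ≡⟨ reduce-eval good-q′ z ⟨
        eval M q′ z             ≡⟨ residual-unique v reachMv reachBv live z ⟩
        eval (normalise B) s z  ≡⟨ residual-unique u reachMu reachBu live z ⟨
        eval M q z              ≡⟨ reduce-eval good-q z ⟩
        eval N q z              ∎))
      where open ≡-Reasoning

  reduce-coarsest : ∀ {n′} (B : Machine n′ k) → (∀ u → behaviour B u ≡ behaviour M u) →
                    ∀ u v → (∀ p q → state B p u ≡ just q → state B p v ≡ just q) →
                    ∀ p q → state M p u ≡ just q → state M p v ≡ just q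
  reduce-coarsest B B≗M u v u⇒v p q reachu with good? p
  ... | no bad = trans (reduce-state-bad bad v) (trans (sym (reduce-state-bad bad u)) reachu)
  ... | yes good
    with w , c , residual-p ← good-residual good
    with (z , _ , evalp) , _ ← good-normal good
    with r , reach ← behaviour-just⁻ B w z (trans (B≗M (w ++ z)) (trans (residual-p z) (⊙-just evalp)))
    = states-agree B B≗M good w reach residual-p u v (u⇒v r) reachu

open CongruenceClass using (coarser)

-- Transducers and machines

record _Implements_ (T : Transducer k) (A : Machine (Transducer.size T) k) : Set where
  open Transducer T
  field
    step-complete  : ∀ {p σ q} (δ : q ∈ Δ p σ) → step A p σ ≡ just (q , o δ)
    step-sound     : ∀ {p σ q x} → step A p σ ≡ just (q , x) → Σ (q ∈ Δ p σ) λ δ → o δ ≡ x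
    final-complete : ∀ {q} (q∈F : q ∈ F) → final A q ≡ just (t q∈F)
    final-sound    : ∀ {q x} → final A q ≡ just x → Σ (q ∈ F) λ q∈F → t q∈F ≡ x
    init-complete  : ∀ {p} (p∈I : p ∈ I) → (p , i p∈I) ≡ (init A , prefix A)
    init-sound     : Σ (init A ∈ I) λ p∈I → i p∈I ≡ prefix A

  run⇒state : ∀ {p w q} → Run p w q → state A p w ≡ just q
  run⇒state []      = refl
  run⇒state (δ ∷ ρ) rewrite step-complete δ = run⇒state ρ

  state⇒run : ∀ {p} w {q} → state A p w ≡ just q → Run p w q
  state⇒run         []      refl  = []
  state⇒run {p = p} (σ ∷ w) reach with step A p σ in stepp
  ... | just (r , x) = proj₁ (step-sound stepp) ∷ state⇒run w reach

  eval-complete : ∀ {p w q} (ρ : Run p w q) (q∈F : q ∈ F) → eval A p w ≡ just (output ρ ++ t q∈F)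
  eval-complete []      q∈F = final-complete q∈F
  eval-complete {w = _ ∷ w} (δ ∷ ρ) q∈F = trans (eval-step A (step-complete δ) w)
    (trans (⊙-just (eval-complete ρ q∈F)) (cong just (sym (List.++-assoc (o δ) (output ρ) (t q∈F)))))

  eval-sound : ∀ {p} w {z} → eval A p w ≡ just z →
               ∃ λ q → Σ (Run p w q) λ ρ → Σ (q ∈ F) λ q∈F → output ρ ++ t q∈F ≡ z
  eval-sound []      eq with q∈F , refl ← final-sound eq = _ , [] , q∈F , refl
  eval-sound {p = p} (σ ∷ w) eq with step A p σ in stepp
  ... | just (r , x)
    with s , evals , refl ← ⊙-just⁻ {m = eval A r w} eq
    with δ , refl ← step-sound stepp
    with q , ρ , q∈F , refl ← eval-sound w evals
    = q , δ ∷ ρ , q∈F , List.++-assoc (o δ) (output ρ) (t q∈F)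

  realizes⇒behaviour : ∀ {u v} → Realizes u v → behaviour A u ≡ just v
  realizes⇒behaviour (accept p∈I ρ q∈F) with refl ← init-complete p∈I = ⊙-just (eval-complete ρ q∈F)

  behaviour⇒realizes : ∀ u {v} → behaviour A u ≡ just v → Realizes u v
  behaviour⇒realizes u eq
    with s , evals , refl ← ⊙-just⁻ {m = eval A (init A) u} eq
    with p∈I , i≡ ← init-sound
    with q , ρ , q∈F , refl ← eval-sound u evals
    = subst (λ x → Realizes u (x ++ output ρ ++ t q∈F)) i≡ (accept p∈I ρ q∈F)

open _Implements_

same-behaviour : ∀ {S T : Transducer k} {A B} → S Implements A → T Implements B →
                 (∀ u v → Transducer.Realizes S u v ⇔ Transducer.Realizes T u v) →
                 ∀ u → behaviour A u ≡ behaviour B u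
same-behaviour S-A T-B S⇔T u = just-or-nothing
  (λ eq → trans eq (sym (realizes⇒behaviour T-B (Equivalence.to (S⇔T u _) (behaviour⇒realizes S-A u eq)))))
  (λ eq → trans (realizes⇒behaviour S-A (Equivalence.from (S⇔T u _) (behaviour⇒realizes T-B u eq))) (sym eq))

same-realization : ∀ {S T : Transducer k} {A B} → S Implements A → T Implements B →
                   (∀ u → behaviour A u ≡ behaviour B u) →
                   ∀ u v → Transducer.Realizes S u v ⇔ Transducer.Realizes T u v
same-realization S-A T-B A≗B u v = mk⇔
  (λ S-uv → behaviour⇒realizes T-B u (trans (sym (A≗B u)) (realizes⇒behaviour S-A S-uv)))
  (λ T-uv → behaviour⇒realizes S-A u (trans (A≗B u) (realizes⇒behaviour T-B T-uv)))

toMachine : (T : Transducer k) → Sequential T → ∃ λ A → T Implements A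
toMachine {k} T (∣I∣≡1 , deterministic) = A , record
  { step-complete  = complete
  ; step-sound     = sound
  ; final-complete = final-complete′
  ; final-sound    = final-sound′
  ; init-complete  = init-complete′
  ; init-sound     = proj₂ start , refl
  }
  where
  open Transducer T

  start : Nonempty I
  start with nonempty? I
  ... | yes start = start
  ... | no empty with () ← trans (sym ∣I∣≡1) (trans (cong ∣_∣ (Empty-unique empty)) (∣⊥∣≡0 size))

  arrow : ∀ {p σ} → Dec (Nonempty (Δ p σ)) → Maybe (State × Word k)
  arrow (yes (q , δ)) = just (q , o δ)
  arrow (no _)        = nothing

  ending : ∀ {q} → Dec (q ∈ F) → Maybe (Word k)
  ending (yes q∈F) = just (t q∈F)
  ending (no _)    = nothing

  A : Machine size k
  A = record
    { step   = λ p σ → arrow (nonempty? (Δ p σ))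
    ; final  = λ q → ending (q ∈? F)
    ; init   = proj₁ start
    ; prefix = i (proj₂ start)
    }

  complete : ∀ {p σ q} (δ : q ∈ Δ p σ) → step A p σ ≡ just (q , o δ)
  complete {p} {σ} δ with nonempty? (Δ p σ)
  ... | no empty = contradiction (_ , δ) empty
  -- Membership proofs are unique, so the output depends only on the transition.
  ... | yes (_ , δ′) with refl ← deterministic δ δ′ with refl ← []=-irrelevant δ δ′ = refl

  sound : ∀ {p σ q x} → step A p σ ≡ just (q , x) → Σ (q ∈ Δ p σ) λ δ → o δ ≡ x
  sound {p} {σ} eq with nonempty? (Δ p σ)
  sound refl | yes (_ , δ) = δ , refl

  final-complete′ : ∀ {q} (q∈F : q ∈ F) → final A q ≡ just (t q∈F)
  final-complete′ {q} q∈F with q ∈? F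
  ... | no q∉F    = contradiction q∈F q∉F
  ... | yes q∈F′ with refl ← []=-irrelevant q∈F q∈F′ = refl

  final-sound′ : ∀ {q x} → final A q ≡ just x → Σ (q ∈ F) λ q∈F → t q∈F ≡ x
  final-sound′ {q} eq with q ∈? F
  final-sound′ refl | yes q∈F = q∈F , refl

  init-complete′ : ∀ {p} (p∈I : p ∈ I) → (p , i p∈I) ≡ (init A , prefix A)
  init-complete′ p∈I with refl ← ∣∣≡1⇒unique ∣I∣≡1 p∈I (proj₂ start)
    = cong (λ m → _ , i m) ([]=-irrelevant p∈I (proj₂ start))

targets : Maybe (Fin n × Word k) → Subset n
targets = maybe (λ (q , _) → ⁅ q ⁆) ∅

∈-targets : ∀ {q : Fin n} (arrow : Maybe (Fin n × Word k)) → q ∈ targets arrow →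
            arrow ≡ just (q , maybe proj₂ [] arrow)
∈-targets nothing        q∈ = contradiction q∈ ∉⊥
∈-targets (just (r , x)) q∈ = cong (λ q → just (q , x)) (sym (x∈⁅y⁆⇒x≡y r q∈))

fromMachine : (A : Machine n k) → Transducer k
fromMachine {n} {k} A = record
  { automaton = record
    { size = n
    ; Δ    = λ p σ → targets (step A p σ)
    ; I    = ⁅ init A ⁆
    ; F    = tabulate (is-just ∘ final A)
    }
  -- The defaults in `o` and `t` are never taken: membership forces the value to be a `just`.
  ; o = λ {p} {σ} _ → maybe proj₂ [] (step A p σ)
  ; i = λ _ → prefix A
  ; t = λ {q} _ → fromMaybe [] (final A q)
  }

module _ (A : Machine n k) where

  fromMachine-sequential : Sequential (fromMachine A)
  fromMachine-sequential = ∣⁅x⁆∣≡1 (init A) , λ {p} {σ} δ₁ δ₂ →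
    cong proj₁ (Maybe.just-injective (trans (sym (∈-targets (step A p σ) δ₁)) (∈-targets (step A p σ) δ₂)))

  fromMachine-implements : fromMachine A Implements A
  fromMachine-implements = record
    { step-complete  = λ {p} {σ} → ∈-targets (step A p σ)
    ; step-sound     = sound
    ; final-complete = final-complete′
    ; final-sound    = final-sound′
    ; init-complete  = λ p∈I → cong (_, prefix A) (x∈⁅y⁆⇒x≡y (init A) p∈I)
    ; init-sound     = x∈⁅x⁆ (init A) , refl
    }
    where
    open Transducer (fromMachine A)

    sound : ∀ {p σ q x} → step A p σ ≡ just (q , x) →
            Σ (q ∈ targets (step A p σ)) λ _ → maybe proj₂ [] (step A p σ) ≡ x
    sound {q = q} eq rewrite eq = x∈⁅x⁆ q , refl

    final-complete′ : ∀ {q} → q ∈ F → final A q ≡ just (fromMaybe [] (final A q))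
    final-complete′ {q} q∈F
      with defined ← trans (sym (lookup∘tabulate (is-just ∘ final A) q)) ([]=⇒lookup q∈F)
      with just _ ← final A q = refl

    final-sound′ : ∀ {q x} → final A q ≡ just x → Σ (q ∈ F) λ _ → fromMaybe [] (final A q) ≡ x
    final-sound′ {q} eq =
      lookup⇒[]= q F (trans (lookup∘tabulate (is-just ∘ final A) q) (cong is-just eq)) ,
      cong (fromMaybe []) eq

-- Transition congruences as kernels

funToFin-cong : ∀ {m} {f g : Fin m → Fin n} → (∀ i → f i ≡ g i) → funToFin f ≡ funToFin g
funToFin-cong {m = zero}  f≗g = refl
funToFin-cong {m = suc m} f≗g = cong₂ combine (f≗g zero) (funToFin-cong (f≗g ∘ suc))

-- The full transformation monoid on `Fin n`. Coding maps as numbers makes pointwise equal maps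
-- equal.
module Transformations (n : ℕ) where

  code : (Fin n → Fin n) → Fin (n ^ n)
  code = funToFin

  decode : Fin (n ^ n) → Fin n → Fin n
  decode = finToFun {n} {n}

  code-cong : ∀ {f g} → (∀ i → f i ≡ g i) → code f ≡ code g
  code-cong = funToFin-cong

  decode-code : ∀ f i → decode (code f) i ≡ f i
  decode-code = Fin.finToFun-funToFin

  code-decode : ∀ f → code (decode f) ≡ f
  code-decode = Fin.funToFin-finToFin {n} {n}

  -- Products are composed from left to right, as words are read.
  transformations : FiniteMonoid
  transformations = record
    { size     = n ^ n
    ; _∙_      = λ f g → code (decode g ∘ decode f)
    ; ε        = code id
    ; isMonoid = record
      { isSemigroup = record
        { isMagma = isMagma _
        ; assoc   = λ f g h → code-cong λ i →
            trans (cong (decode h) (decode-code (decode g ∘ decode f) i))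
                  (sym (decode-code (decode h ∘ decode g) (decode f i)))
        }
      ; identity = (λ f → trans (code-cong λ i → cong (decode f) (decode-code id i)) (code-decode f))
                 , (λ f → trans (code-cong λ i → decode-code id (decode f i)) (code-decode f))
      }
    }

module Presentation (A : Machine n k) where
  open Transformations (suc n)

  -- zero is a sink that makes the transition function total.
  letter : Fin k → Fin (suc n) → Fin (suc n)
  letter σ zero    = zero
  letter σ (suc p) = encodeMaybe (map proj₁ (step A p σ))

  action : Word k → Fin (suc n ^ suc n)
  action = extend transformations (code ∘ letter)

  act : Word k → Fin (suc n) → Fin (suc n)
  act w = decode (action w)

  act-∷ : ∀ σ w i → act (σ ∷ w) i ≡ act w (letter σ i)
  act-∷ σ w i = trans (decode-code (act w ∘ decode (code (letter σ))) i)
                      (cong (act w) (decode-code (letter σ) i))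

  act-sink : ∀ w → act w zero ≡ zero
  act-sink []      = decode-code id zero
  act-sink (σ ∷ w) = trans (act-∷ σ w zero) (act-sink w)

  act-state : ∀ w p → act w (suc p) ≡ encodeMaybe (state A p w)
  act-state []      p = decode-code id (suc p)
  act-state (σ ∷ w) p = trans (act-∷ σ w (suc p)) rest
    where
    rest : act w (encodeMaybe (map proj₁ (step A p σ))) ≡ encodeMaybe (state A p (σ ∷ w))
    rest with step A p σ
    ... | nothing      = act-sink w
    ... | just (q , _) = act-state w q

  action⇒state : ∀ u v → action u ≡ action v → ∀ p → state A p u ≡ state A p v
  action⇒state u v eq p = encodeMaybe-injective _ _
    (trans (sym (act-state u p)) (trans (cong (λ f → decode f (suc p)) eq) (act-state v p)))

  -- The sink is fixed by every word, so the maps agree everywhere. With `action⇒state`, the kernel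
  -- of `action` is the relation of acting alike on states.
  state⇒action : ∀ u v → (∀ p → state A p u ≡ state A p v) → action u ≡ action v
  state⇒action u v eq =
    trans (sym (code-decode (action u))) (trans (code-cong pointwise) (code-decode (action v)))
    where
    pointwise : ∀ i → act u i ≡ act v i
    pointwise zero    = trans (act-sink u) (sym (act-sink v))
    pointwise (suc p) = trans (act-state u p) (trans (cong encodeMaybe (eq p)) (sym (act-state v p)))

module _ {T : Transducer k} {A} (T-A : T Implements A) where
  open Transducer T using (transitionCongruence)

  ≈⇒state : ∀ {u v} → Congruence._∼_ transitionCongruence u v → ∀ p → state A p u ≡ state A p v
  ≈⇒state {u} {v} u≈v p = just-or-nothing
    (λ eq → trans eq (sym (run⇒state T-A (Equivalence.to (u≈v p _) (state⇒run T-A u eq)))))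
    (λ eq → trans (run⇒state T-A (Equivalence.from (u≈v p _) (state⇒run T-A v eq))) (sym eq))

  state⇒≈ : ∀ {u v} → (∀ p q → state A p u ≡ just q → state A p v ≡ just q) →
            (∀ p q → state A p v ≡ just q → state A p u ≡ just q) →
            Congruence._∼_ transitionCongruence u v
  state⇒≈ {u} {v} to from p q = mk⇔
    (λ ρ → state⇒run T-A v (to p q (run⇒state T-A ρ)))
    (λ ρ → state⇒run T-A u (from p q (run⇒state T-A ρ)))

  -- The kernel and the transition congruence relate the same words; closure under coarser
  -- congruences, used both ways, carries membership between them.
  isVTransducer? : ∀ {ℓ} (V : CongruenceClass ℓ) → DecidableClass V → Dec (IsVTransducer V T)
  isVTransducer? V V? = map′
    (coarser V kernelA transitionCongruence λ {u} {v} eq → state⇒≈ {u} {v}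
      (λ p q reach → trans (sym (action⇒state u v eq p)) reach)
      (λ p q reach → trans (action⇒state u v eq p) reach))
    (coarser V transitionCongruence kernelA λ {u} {v} u≈v → state⇒action u v (≈⇒state {u} {v} u≈v))
    (V? transformations (code ∘ letter))
    where
    open Transformations (suc _)
    open Presentation A
    kernelA : Congruence k
    kernelA = kernel transformations (code ∘ letter)

-- Comparing transition congruences and deciding 𝒱-sequentiality

implements-coarser : ∀ {S T : Transducer k} {A B} → S Implements A → T Implements B →
  (∀ u v → (∀ p q → state A p u ≡ just q → state A p v ≡ just q) →
           (∀ p q → state B p u ≡ just q → state B p v ≡ just q)) →
  Congruence._∼_ (Transducer.transitionCongruence S) ⇒ Congruence._∼_ (Transducer.transitionCongruence T)
implements-coarser S-A T-B transfer {u} {v} u≈v = state⇒≈ T-B {u} {v}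
  (transfer u v λ p q reach → trans (sym (≈⇒state S-A {u} {v} u≈v p)) reach)
  (transfer v u λ p q reach → trans (≈⇒state S-A {u} {v} u≈v p) reach)

theorem2p1 : ∀ {ℓ} (V : CongruenceClass ℓ) → DecidableClass V →
    ∀ {k} (T : Transducer k) (T-seq : Sequential T) →
    Dec (VSequential V (transduction T T-seq))
theorem2p1 V V? {k} T T-seq = map′
  (λ M∈V → fromMachine M , fromMachine-sequential M , M∈V ,
           same-realization M-implements T-A (sym ∘ A≗M))
  minimal
  (isVTransducer? M-implements V V?)
  where
  A = proj₁ (toMachine T T-seq)
  T-A = proj₂ (toMachine T T-seq)

  -- After normalisation, live states are normal and no transition enters a dead state.
  open Reduction (normalise A) (λ live → normalise-normal A (live-normalise⁻ A live))
                 (λ stepp → live-normalise A (normalise-step A stepp))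

  M = reduce
  M-implements = fromMachine-implements M

  A≗M : ∀ u → behaviour A u ≡ behaviour M u
  A≗M u = trans (normalise-behaviour A u) (reduce-behaviour u)

  minimal : VSequential V (transduction T T-seq) → IsVTransducer V (fromMachine M)
  minimal (T′ , T′-seq , T′∈V , T′⇔T) =
    -- The congruence of `M` is coarser than that of any sequential transducer for the transduction,
    -- in particular of one in 𝒱.
    coarser V (Transducer.transitionCongruence T′) (Transducer.transitionCongruence (fromMachine M))
      (implements-coarser T′-B M-implements (reduce-coarsest B B≗M)) T′∈V
    where
    B = proj₁ (toMachine T′ T′-seq)
    T′-B = proj₂ (toMachine T′ T′-seq)

    B≗M : ∀ u → behaviour B u ≡ behaviour M u
    B≗M u = trans (same-behaviour T′-B T-A T′⇔T u) (A≗M u)
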